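{- Let $n\ge2$, let $\mathbf A=(A,q,\mathsf e_1,\dots,\mathsf e_n)$ be an $n\mathrm{BA}$, and fix $i\ne j$ in $\{1,\dots,n\}$. Let $\phi$ be a congruence on $\mathbf A$ and $H=(H_1,\dots,H_n)$ be a multideal of $\mathbf A$. Then $$\theta_{I(\phi)}=\phi\quad\text{and}\quad I(\theta_H)=H.$$
   Context: Let $n\ge 2$. An $n\mathrm{BA}$ (Boolean-like algebra of dimension $n$) is an algebra $\mathbf A=(A,q,\mathsf e_1,\dots,\mathsf e_n)$ with $q$ of arity $n+1$ and constants $\mathsf e_1,\dots,\mathsf e_n$ satisfying the identities (B0) $q(\mathsf e_i,x^1,\dots,x^n)=x^i$ for $i=1,\dots,n$; (B1) $q(y,x,\dots,x)=x$; (B2) $q(y,q(y,x^{11},\dots,x^{1n}),\dots,q(y,x^{n1},\dots,x^{nn}))=q(y,x^{11},x^{22},\dots,x^{nn})$; (B3) $q(y,q(x^{10},\dots,x^{1n}),\dots,q(x^{n0},\dots,x^{nn}))=q(q(y,x^{10},\dots,x^{n0}),\dots,q(y,x^{1n},\dots,x^{nn}))$; (B4) $q(y,\mathsf e_1,\dots,\mathsf e_n)=y$. For $k\in\{1,\dots,n\}$ let $t_k(x,y,z)=q(x,w_1,\dots,w_n)$ with $w_k=z$ and $w_m=y$ for $m\ne k$; $x\land_i y=t_i(x,y,\mathsf e_i)$; $x\,\overline\vee_i\,y=t_i(x,x,y)$; $x\le^i y$ iff $x\land_i y=x=y\land_i x$. A multideal of $\mathbf A$ is a tuple $(I_1,\dots,I_n)$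 of pairwise disjoint subsets of $A$ such that: (m1) $\mathsf e_k\in I_k$ for all $k$; (m2) if $a\in I_r$, $b\in I_k$ and $y_1,\dots,y_n\in A$, then $q(a,y_1,\dots,y_{r-1},b,y_{r+1},\dots,y_n)\in I_k$; (m3) if $a\in A$ and $y_1,\dots,y_n\in I_k$, then $q(a,y_1,\dots,y_n)\in I_k$. By convention the constant tuple $(A,\dots,A)$ is also allowed, as a degenerate multideal. For a congruence $\phi$, $I(\phi)=(\mathsf e_1/\phi,\dots,\mathsf e_n/\phi)$; it is a multideal when $\phi\ne A\times A$, and it is the degenerate multideal $(A,\dots,A)$ when $\phi=A\times A$. Fix $i\ne j$. The Boolean center $B_{ij}=\{x\in A: x\le^i\mathsf e_j\}$ is a Boolean algebra with meet $\land_i$, join $\overline\vee_i$, complement $\neg_{ij}(x)=t_i(x,\mathsf e_i,\mathsf e_j)$, bottom $\mathsf e_i$ and top $\mathsf e_j$. The coordinates of $x\in A$ are $x_k=t_k(x,\mathsf e_i,\mathsf e_j)\in B_{ij}$, $1\le k\le n$. For a (possibly degenerate) multideal $I$, $I_*=B_{ij}\cap I_i$ is a Boolean ideal of $B_{ij}$; let $f_I:B_{ij}\to B_{ij}/I_*$ be the quotient homomorphism, and define $x\,\theta_I\,y$ iff $f_I(x_k)=f_I(y_k)$ for all $1\le k\le n$. -}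

module Defs where

open import Level using (Level; _⊔_; suc)
open import Data.Nat.Base using (ℕ)
open import Data.Fin.Base using (Fin)
open import Data.Fin.Properties using (_≟_)
open import Data.Product.Base using (Σ; _×_; _,_; proj₁)
open import Data.Sum.Base using (_⊎_)
open import Data.Vec.Functional using (Vector; replicate; updateAt)
open import Data.Vec.Functional.Properties using (updateAt-updates; updateAt-minimal)
open import Function.Base using (const)
open import Relation.Binary.Bundles using (Setoid)
open import Relation.Binary.Core using (Rel; _⇒_)
open import Relation.Binary.Definitions using (_Respects_)
open import Relation.Binary.PropositionalEquality.Core as ≡ using (_≡_; _≢_)
open import Relation.Binary.Structures using (IsEquivalence)
open import Relation.Nullary using (yes; no)
open import Relation.Unary using (Pred; _∈_; _∩_; _⊥_; Universal)
import Relation.Binary.Reasoning.Setoid as SetoidReasoning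

private
  variable
    a ℓ ℓ₁ ℓ₂ : Level
    n : ℕ

infix 8 _[_]≔_

_[_]≔_ : {X : Set a} → Vector X n → Fin n → X → Vector X n
xs [ k ]≔ x = updateAt xs k (const x)

-- The (n+1)-ary operation q takes its first argument separately from the
-- remaining n, which are given as a vector. As for the algebraic bundles of
-- the standard library, equality in the algebra is a setoid equality.

record NBA (n : ℕ) (a ℓ : Level) : Set (suc (a ⊔ ℓ)) where
  infix 4 _≈_
  field
    Carrier       : Set a
    _≈_           : Rel Carrier ℓ
    isEquivalence : IsEquivalence _≈_
    q             : Carrier → Vector Carrier n → Carrier
    e             : Vector Carrier n
    q-cong        : ∀ {x y} {xs ys : Vector Carrier n} →
                    x ≈ y → (∀ k → xs k ≈ ys k) → q x xs ≈ q y ys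
    B0            : ∀ k xs → q (e k) xs ≈ xs k
    B1            : ∀ y x → q y (replicate n x) ≈ x
    B2            : ∀ y (x : Fin n → Fin n → Carrier) →
                    q y (λ k → q y (x k)) ≈ q y (λ k → x k k)
    -- z m plays the role of x^{m0}, and x m l that of x^{ml} for l ≥ 1.
    B3            : ∀ y z (x : Fin n → Fin n → Carrier) →
                    q y (λ m → q (z m) (x m)) ≈ q (q y z) (λ l → q y (λ m → x m l))
    B4            : ∀ y → q y e ≈ y

  setoid : Setoid a ℓ
  setoid = record { isEquivalence = isEquivalence }

  open IsEquivalence isEquivalence public

module _ (𝐀 : NBA n a ℓ) where
  open NBA 𝐀

  record IsCongruence (φ : Rel Carrier ℓ₁) : Set (a ⊔ ℓ ⊔ ℓ₁) where
    field
      isEquivalence : IsEquivalence φ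
      -- φ is a relation on the underlying setoid
      reflexive-≈   : _≈_ ⇒ φ
      compatible    : ∀ {x y} {xs ys : Vector Carrier n} →
                      φ x y → (∀ k → φ (xs k) (ys k)) → φ (q x xs) (q y ys)

  record IsProperMultideal (I : Fin n → Pred Carrier ℓ₁) : Set (a ⊔ ℓ₁) where
    field
      disjoint : ∀ {r k} → r ≢ k → I r ⊥ I k
      m1       : ∀ k → e k ∈ I k
      m2       : ∀ {r k x y} (ys : Vector Carrier n) →
                 x ∈ I r → y ∈ I k → q x (ys [ r ]≔ y) ∈ I k
      m3       : ∀ {k} x (ys : Vector Carrier n) →
                 (∀ m → ys m ∈ I k) → q x ys ∈ I k

  record IsMultideal (I : Fin n → Pred Carrier ℓ₁) : Set (a ⊔ ℓ ⊔ ℓ₁) where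
    field
      -- the components are subsets of the underlying setoid
      respects             : ∀ k → I k Respects _≈_
      properOrDegenerate   : IsProperMultideal I ⊎ (∀ k → Universal (I k))

  -- The tuple (e₁/φ, …, eₙ/φ).
  classes : Rel Carrier ℓ₁ → Fin n → Pred Carrier ℓ₁
  classes φ k x = φ x (e k)

  t : Fin n → Carrier → Carrier → Carrier → Carrier
  t k x y z = q x (replicate n y [ k ]≔ z)

  meet : Fin n → Carrier → Carrier → Carrier
  meet i x y = t i x y (e i)

  join : Fin n → Carrier → Carrier → Carrier
  join i x y = t i x x y

  infix 4 _≤[_]_

  _≤[_]_ : Carrier → Fin n → Carrier → Set ℓ
  x ≤[ i ] y = (meet i x y ≈ x) × (x ≈ meet i y x)

  module _ (i j : Fin n) where

    neg : Carrier → Carrier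
    neg x = t i x (e i) (e j)

    InCenter : Pred Carrier ℓ
    InCenter x = x ≤[ i ] e j

    Center : Set (a ⊔ ℓ)
    Center = Σ Carrier InCenter

    symmetricDifference : Carrier → Carrier → Carrier
    symmetricDifference x y = join i (meet i x (neg y)) (meet i (neg x) y)

    -- I_*, a Boolean ideal of the Boolean center when I is a multideal
    centerIdeal : (Fin n → Pred Carrier ℓ₁) → Pred Carrier (ℓ ⊔ ℓ₁)
    centerIdeal I = InCenter ∩ I i

    -- Equality of f_I(x) and f_I(y) in the quotient of the Boolean center by
    -- the Boolean ideal I_*: the symmetric difference of x and y is in I_*.
    -- The quotient has the same underlying type as the Boolean center, and
    -- this relation as its equality.
    EqualInQuotient : (Fin n → Pred Carrier ℓ₁) → Rel Center (ℓ ⊔ ℓ₁)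
    EqualInQuotient I x y = symmetricDifference (proj₁ x) (proj₁ y) ∈ centerIdeal I

  module _ {i j : Fin n} (i≢j : i ≢ j) where

    t-inCenter : ∀ k x → t k x (e i) (e j) ∈ InCenter i j
    t-inCenter k x = below , above
      where
      open SetoidReasoning setoid

      zs : Vector Carrier n
      zs = replicate n (e i) [ k ]≔ e j

      ws : Vector Carrier n
      ws = replicate n (e j) [ i ]≔ e i

      entry : ∀ m → q (zs m) ws ≈ zs m
      entry m with m ≟ k
      ... | yes ≡.refl rewrite updateAt-updates k {f = const (e j)} (replicate n (e i)) =
        trans (B0 j ws)
          (reflexive (updateAt-minimal j i (replicate n (e j)) λ j≡i → i≢j (≡.sym j≡i)))
      ... | no m≢k rewrite updateAt-minimal m k {f = const (e j)} (replicate n (e i)) m≢k =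
        trans (B0 i ws) (reflexive (updateAt-updates i (replicate n (e j))))

      below : meet i (t k x (e i) (e j)) (e j) ≈ t k x (e i) (e j)
      below = begin
        q (q x zs) ws                           ≈⟨ q-cong refl (λ l → sym (B1 x (ws l))) ⟩
        q (q x zs) (λ l → q x (λ _ → ws l))     ≈⟨ sym (B3 x zs (λ _ → ws)) ⟩
        q x (λ m → q (zs m) ws)                 ≈⟨ q-cong refl entry ⟩
        q x zs                                  ∎

      above : t k x (e i) (e j) ≈ meet i (e j) (t k x (e i) (e j))
      above = sym (trans (B0 j _)
        (reflexive (updateAt-minimal j i (replicate n _) λ j≡i → i≢j (≡.sym j≡i))))

    coordinate : Fin n → Carrier → Center i j
    coordinate k x = t k x (e i) (e j) , t-inCenter k x

    θ : (Fin n → Pred Carrier ℓ₁) → Rel Carrier (ℓ ⊔ ℓ₁)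
    θ I x y = ∀ k → EqualInQuotient i j I (coordinate k x) (coordinate k y)

{-# OPTIONS --safe #-}

-- For fixed x and y the map D ↦ q(x, a ↦ q(y, b ↦ D a b)) is, by B1 and B3, a
-- homomorphism from the power algebra A^(n×n) to A, and it sends the tables
-- (a, b) ↦ e a and (a, b) ↦ e b to x and y. So an identity in x and y holds as
-- soon as it holds at the constants. Let δ k x y be the symmetric difference of
-- the k-th coordinates of x and y. Checking at the constants gives
--   x ≈ q(x, k ↦ tᵢ(δ k x y, x, y)),
-- so x is φ-related to y when all δ k x y are φ-related to eᵢ, and x ∈ Hₗ when
-- y = eₗ and all δ k x y are in Hᵢ. The converse inclusions follow from
-- δ k x x ≈ eᵢ and δ k x eₗ ≈ q(x, m ↦ δ k eₘ eₗ), where the l-th entry is eᵢ.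
module Submission where

open import Defs
open import Level using (Level)
open import Data.Nat.Base using (ℕ; _≤_)
open import Data.Fin.Base using (Fin; zero; suc)
open import Data.Fin.Properties using (_≟_)
open import Data.Product.Base using (_×_; _,_; proj₂)
open import Data.Sum.Base using (_⊎_; inj₁; inj₂; [_,_]′)
open import Data.Unit.Base using (⊤; tt)
open import Data.Vec.Functional using (Vector; replicate)
open import Data.Vec.Functional.Properties using (updateAt-updates; updateAt-minimal)
open import Function.Base using (const)
open import Relation.Binary.Core using (Rel; _⇔_; _⇒_)
open import Relation.Binary.PropositionalEquality.Core as ≡ using (_≢_)
open import Relation.Binary.Structures using (IsEquivalence)
open import Relation.Nullary using (yes; no)
open import Relation.Unary using (Pred; _≐_; _⊆_; _∈_)
import Relation.Binary.Reasoning.Setoid as SetoidReasoning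

private
  variable
    a b ℓ ℓ₁ : Level
    n : ℕ

-- Stated for families over `B` so that one induction on positions serves twice: `B = ⊤` makes `t`
-- compatible with congruences, `B = Fin n × Fin n` makes it commute with averaging.
replicate-≔-lift : {X : Set a} {B : Set b} (R : X → (B → X) → Set ℓ)
                   {y z : X} {D E : B → X} → R y D → R z E → (k m : Fin n) →
                   R ((replicate n y [ k ]≔ z) m) (λ β → (replicate n (D β) [ k ]≔ E β) m)
replicate-≔-lift R yD zE zero    zero    = zE
replicate-≔-lift R yD zE zero    (suc m) = yD
replicate-≔-lift R yD zE (suc k) zero    = yD
replicate-≔-lift R yD zE (suc k) (suc m) = replicate-≔-lift R yD zE k m

-- Congruences and the evaluation of `t` at constants.

module _ (𝐀 : NBA n a ℓ) where
  open NBA 𝐀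
  open SetoidReasoning setoid

  ≈-isCongruence : IsCongruence 𝐀 _≈_
  ≈-isCongruence = record
    { isEquivalence = isEquivalence
    ; reflexive-≈   = λ x≈y → x≈y
    ; compatible    = q-cong
    }

  module _ {φ : Rel Carrier ℓ₁} (φ-cong : IsCongruence 𝐀 φ) where
    open IsCongruence φ-cong using (compatible)
    private module φ = IsEquivalence (IsCongruence.isEquivalence φ-cong)

    t-compatible : ∀ k {x x′ y y′ z z′} → φ x x′ → φ y y′ → φ z z′ →
                   φ (t 𝐀 k x y z) (t 𝐀 k x′ y′ z′)
    t-compatible k xx′ yy′ zz′ =
      compatible xx′ (replicate-≔-lift {B = ⊤} (λ u f → φ u (f tt)) yy′ zz′ k)

    symmetricDifference-compatible :
      ∀ i j {x x′ y y′} → φ x x′ → φ y y′ →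
      φ (symmetricDifference 𝐀 i j x y) (symmetricDifference 𝐀 i j x′ y′)
    symmetricDifference-compatible i j xx′ yy′ =
      t-compatible i x∧¬y x∧¬y (t-compatible i ¬x yy′ φ.refl)
      where
      ¬x   = t-compatible i xx′ φ.refl φ.refl
      x∧¬y = t-compatible i xx′ (t-compatible i yy′ φ.refl φ.refl) φ.refl

  t-cong : ∀ k {x x′ y y′ z z′} → x ≈ x′ → y ≈ y′ → z ≈ z′ →
           t 𝐀 k x y z ≈ t 𝐀 k x′ y′ z′
  t-cong = t-compatible ≈-isCongruence

  t-e : ∀ k y z → t 𝐀 k (e k) y z ≈ z
  t-e k y z = trans (B0 k _) (reflexive (updateAt-updates k (replicate n y)))

  t-e-≢ : ∀ {k m} → m ≢ k → ∀ y z → t 𝐀 k (e m) y z ≈ y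
  t-e-≢ {k} {m} m≢k y z =
    trans (B0 m _) (reflexive (updateAt-minimal m k (replicate n y) m≢k))

  -- Serves to bring a vector into the updated form that `m2` asks for.
  ≔-≈ : ∀ (ys : Vector Carrier n) k {z} → z ≈ ys k → ∀ m → (ys [ k ]≔ z) m ≈ ys m
  ≔-≈ ys k {z} z≈ m with m ≟ k
  ... | yes ≡.refl = trans (reflexive (updateAt-updates k {f = const z} ys)) z≈
  ... | no m≢k     = reflexive (updateAt-minimal m k {f = const z} ys m≢k)

  -- Averaging tables indexed by pairs of constants.

  module _ (x y : Carrier) where

    average : (Fin n × Fin n → Carrier) → Carrier
    average D = q x λ a → q y λ b → D (a , b)

    average-cong : ∀ {D E} → (∀ a b → D (a , b) ≈ E (a , b)) → average D ≈ average E
    average-cong D≈E = q-cong refl λ a → q-cong refl (D≈E a)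

    infix 4 _≈avg_

    -- Represents an element by a table; the `avg-` lemmas build the table of a term along its
    -- structure.
    _≈avg_ : Carrier → (Fin n × Fin n → Carrier) → Set ℓ
    F ≈avg D = F ≈ average D

    avg-const : ∀ c → c ≈avg const c
    avg-const c = sym (trans (q-cong refl λ _ → B1 y c) (B1 x c))

    avg-fst : x ≈avg λ (a , _) → e a
    avg-fst = sym (trans (q-cong refl λ a → B1 y (e a)) (B4 x))

    avg-snd : y ≈avg λ (_ , b) → e b
    avg-snd = sym (trans (q-cong refl λ _ → B4 y) (B1 x y))

    avg-q : ∀ {F D} {G : Vector Carrier n} {E : Fin n → Fin n × Fin n → Carrier} →
            F ≈avg D → (∀ k → G k ≈avg E k) → q F G ≈avg λ ab → q (D ab) λ k → E k ab
    avg-q {F} {D} {G} {E} F≈ G≈ = begin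
      q F G
        ≈⟨ q-cong F≈ G≈ ⟩
      q (average D) (λ k → average (E k))
        -- `B3` is read from right to left twice, first to pull out the outer `q x`, then the inner
        -- `q y`.
        ≈⟨ B3 x _ (λ a k → q y λ b → E k (a , b)) ⟨
      q x (λ a → q (q y λ b → D (a , b)) λ k → q y λ b → E k (a , b))
        ≈⟨ q-cong refl (λ a → B3 y (λ b → D (a , b)) λ b k → E k (a , b)) ⟨
      average (λ ab → q (D ab) λ k → E k ab) ∎

    avg-t : ∀ k {F G K D E J} → F ≈avg D → G ≈avg E → K ≈avg J →
            t 𝐀 k F G K ≈avg λ ab → t 𝐀 k (D ab) (E ab) (J ab)
    avg-t k F≈ G≈ K≈ = avg-q F≈ (replicate-≔-lift _≈avg_ G≈ K≈ k)

    avg-symmetricDifference :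
      ∀ i j {F G D E} → F ≈avg D → G ≈avg E →
      symmetricDifference 𝐀 i j F G ≈avg λ ab → symmetricDifference 𝐀 i j (D ab) (E ab)
    avg-symmetricDifference i j F≈ G≈ = avg-t i F∧¬G F∧¬G (avg-t i ¬F G≈ (avg-const _))
      where
      ¬F   = avg-t i F≈ (avg-const _) (avg-const _)
      F∧¬G = avg-t i F≈ (avg-t i G≈ (avg-const _) (avg-const _)) (avg-const _)

  -- Symmetric difference on bottom and top of the Boolean center.

  module _ {i j : Fin n} (i≢j : i ≢ j) where

    private
      j≢i : j ≢ i
      j≢i j≡i = i≢j (≡.sym j≡i)

      _△_ : Carrier → Carrier → Carrier
      _△_ = symmetricDifference 𝐀 i j

      △-cong : ∀ {x x′ y y′} → x ≈ x′ → y ≈ y′ → x △ y ≈ x′ △ y′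
      △-cong = symmetricDifference-compatible ≈-isCongruence i j

    △-identityˡ : ∀ y → e i △ y ≈ y
    △-identityˡ y = begin
      e i △ y                       ≈⟨ t-cong i ei∧ ei∧ (t-cong i (t-e i _ _) refl refl) ⟩
      join 𝐀 i (e i) (meet 𝐀 i (e j) y)
                                    ≈⟨ t-e i _ _ ⟩
      meet 𝐀 i (e j) y              ≈⟨ t-e-≢ j≢i _ _ ⟩
      y                             ∎
      where
      ei∧ : ∀ {z} → meet 𝐀 i (e i) z ≈ e i
      ei∧ = t-e i _ _

    △-topˡ : ∀ y → e j △ y ≈ join 𝐀 i (neg 𝐀 i j y) (e i)
    △-topˡ y = t-cong i ej∧ ej∧ (trans (t-cong i (t-e-≢ j≢i _ _) refl refl) (t-e i _ _))
      where
      ej∧ : ∀ {z} → meet 𝐀 i (e j) z ≈ z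
      ej∧ = t-e-≢ j≢i _ _

    △-top-bottom : e j △ e i ≈ e j
    △-top-bottom = begin
      e j △ e i                            ≈⟨ △-topˡ (e i) ⟩
      join 𝐀 i (neg 𝐀 i j (e i)) (e i)     ≈⟨ t-cong i ¬ei ¬ei refl ⟩
      join 𝐀 i (e j) (e i)                 ≈⟨ t-e-≢ j≢i _ _ ⟩
      e j                                  ∎
      where
      ¬ei = t-e i _ _

    △-top-top : e j △ e j ≈ e i
    △-top-top = begin
      e j △ e j                            ≈⟨ △-topˡ (e j) ⟩
      join 𝐀 i (neg 𝐀 i j (e j)) (e i)     ≈⟨ t-cong i ¬ej ¬ej refl ⟩
      join 𝐀 i (e i) (e i)                 ≈⟨ t-e i _ _ ⟩
      e i                                  ∎
      where
      ¬ej = t-e-≢ j≢i _ _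

    -- The coordinates of constants take only these two values, so identities at constants reduce to
    -- a truth table.
    Bit : Pred Carrier ℓ
    Bit c = c ≈ e i ⊎ c ≈ e j

    △-bit : ∀ {c d} → c ∈ Bit → d ∈ Bit → c △ d ∈ Bit
    △-bit (inj₁ c≈) (inj₁ d≈) = inj₁ (trans (△-cong c≈ d≈) (△-identityˡ _))
    △-bit (inj₁ c≈) (inj₂ d≈) = inj₂ (trans (△-cong c≈ d≈) (△-identityˡ _))
    △-bit (inj₂ c≈) (inj₁ d≈) = inj₂ (trans (△-cong c≈ d≈) △-top-bottom)
    △-bit (inj₂ c≈) (inj₂ d≈) = inj₁ (trans (△-cong c≈ d≈) △-top-top)

    △-bit-self : ∀ {c} → c ∈ Bit → c △ c ≈ e i
    △-bit-self (inj₁ c≈) = trans (△-cong c≈ c≈) (△-identityˡ _)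
    △-bit-self (inj₂ c≈) = trans (△-cong c≈ c≈) △-top-top

    bit-∧-top : ∀ {c} → c ∈ Bit → meet 𝐀 i c (e j) ≈ c
    bit-∧-top (inj₁ c≈) = trans (t-cong i c≈ refl refl) (trans (t-e i _ _) (sym c≈))
    bit-∧-top (inj₂ c≈) = trans (t-cong i c≈ refl refl) (trans (t-e-≢ j≢i _ _) (sym c≈))

    -- Coordinates and their symmetric differences.

    coord : Fin n → Carrier → Carrier
    coord k x = t 𝐀 k x (e i) (e j)

    coord-e-bit : ∀ k m → coord k (e m) ∈ Bit
    coord-e-bit k m with m ≟ k
    ... | yes ≡.refl = inj₂ (t-e k _ _)
    ... | no m≢k     = inj₁ (t-e-≢ m≢k _ _)

    δ : Fin n → Carrier → Carrier → Carrier
    δ k x y = coord k x △ coord k y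

    δ-e-bit : ∀ k l m → δ k (e l) (e m) ∈ Bit
    δ-e-bit k l m = △-bit (coord-e-bit k l) (coord-e-bit k m)

    δ-e-self : ∀ k m → δ k (e m) (e m) ≈ e i
    δ-e-self k m = △-bit-self (coord-e-bit k m)

    -- The `l`-th coordinate separates the two constants: it is top at `e l` and bottom at `e m`.
    δ-e-≢ : ∀ {l m} → l ≢ m → δ l (e l) (e m) ≈ e j
    δ-e-≢ {l} l≢m =
      trans (△-cong (t-e l _ _) (t-e-≢ (λ m≡l → l≢m (≡.sym m≡l)) _ _)) △-top-bottom

    avg-δ : ∀ x y k → δ k x y ≈ average x y λ (l , m) → δ k (e l) (e m)
    avg-δ x y k = avg-symmetricDifference x y i j (avg-coord (avg-fst x y)) (avg-coord (avg-snd x y))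
      where
      avg-coord : ∀ {F D} → F ≈ average x y D → coord k F ≈ average x y λ lm → coord k (D lm)
      avg-coord F≈ = avg-t x y k F≈ (avg-const x y _) (avg-const x y _)

    -- One half is an identity in `x` and `y`, checked on the bits at constants; the other holds
    -- because `e j` is neutral on the left of the meet.
    δ-inCenter : ∀ k x y → δ k x y ∈ InCenter 𝐀 i j
    δ-inCenter k x y = below , sym (t-e-≢ j≢i _ _)
      where
      below : meet 𝐀 i (δ k x y) (e j) ≈ δ k x y
      below = begin
        meet 𝐀 i (δ k x y) (e j)
          ≈⟨ avg-t x y i (avg-δ x y k) (avg-const x y _) (avg-const x y _) ⟩
        average x y (λ (l , m) → meet 𝐀 i (δ k (e l) (e m)) (e j))
          ≈⟨ average-cong x y (λ l m → bit-∧-top (δ-e-bit k l m)) ⟩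
        average x y (λ (l , m) → δ k (e l) (e m))
          ≈⟨ avg-δ x y k ⟨
        δ k x y ∎

    -- For equal arguments `B2` collapses the table to its diagonal, where the bits cancel.
    δ-self : ∀ k x → δ k x x ≈ e i
    δ-self k x = begin
      δ k x x                                      ≈⟨ avg-δ x x k ⟩
      average x x (λ (l , m) → δ k (e l) (e m))    ≈⟨ B2 x _ ⟩
      q x (λ m → δ k (e m) (e m))                  ≈⟨ q-cong refl (δ-e-self k) ⟩
      q x (replicate n (e i))                      ≈⟨ B1 x (e i) ⟩
      e i                                          ∎

    δ-eʳ : ∀ k x m → δ k x (e m) ≈ q x λ l → δ k (e l) (e m)
    δ-eʳ k x m = trans (avg-δ x (e m) k) (q-cong refl λ l → B0 m _)

    δ-recovers : ∀ x y → x ≈ q x λ k → t 𝐀 i (δ k x y) x y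
    δ-recovers x y = sym (begin
      q x (λ k → t 𝐀 i (δ k x y) x y)
        ≈⟨ avg-q x y (avg-fst x y) (λ k →
             avg-t x y i (avg-δ x y k) (avg-fst x y) (avg-snd x y)) ⟩
      average x y (λ (l , m) → q (e l) λ k → t 𝐀 i (δ k (e l) (e m)) (e l) (e m))
        ≈⟨ average-cong x y (λ l m → trans (B0 l _) (at-e l m)) ⟩
      average x y (λ (l , _) → e l)
        ≈⟨ avg-fst x y ⟨
      x ∎)
      where
      -- At `x = e l` the outer `q` selects `k = l`. If `l` is `m`, `δ` is bottom and `t` picks
      -- `e m`, which is `e l`; otherwise `δ` is top and `t` picks `e l`.
      at-e : ∀ l m → t 𝐀 i (δ l (e l) (e m)) (e l) (e m) ≈ e l
      at-e l m with l ≟ m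
      ... | yes ≡.refl = trans (t-cong i (δ-e-self l l) refl refl) (t-e i _ _)
      ... | no l≢m     = trans (t-cong i (δ-e-≢ l≢m) refl refl) (t-e-≢ j≢i _ _)

    -- From a congruence to its classes and back.

    module _ {φ : Rel Carrier ℓ₁} (φ-cong : IsCongruence 𝐀 φ) where
      open IsCongruence φ-cong using (reflexive-≈; compatible)
      private module φ = IsEquivalence (IsCongruence.isEquivalence φ-cong)

      θ-classes⇒ : θ 𝐀 i≢j (classes 𝐀 φ) ⇒ φ
      θ-classes⇒ {x} {y} xθy =
        φ.trans (reflexive-≈ (δ-recovers x y))
          (φ.trans (compatible φ.refl entry) (reflexive-≈ (B1 x y)))
        where
        -- Modulo `φ` each `δ k x y` becomes `e i`, which makes `t` pick `y`.
        entry : ∀ k → φ (t 𝐀 i (δ k x y) x y) y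
        entry k = φ.trans (t-compatible φ-cong i (proj₂ (xθy k)) φ.refl φ.refl)
                          (reflexive-≈ (t-e i x y))

      ⇒θ-classes : φ ⇒ θ 𝐀 i≢j (classes 𝐀 φ)
      ⇒θ-classes {x} {y} xφy k = δ-inCenter k x y ,
        φ.trans (symmetricDifference-compatible φ-cong i j (t-compatible φ-cong k xφy φ.refl φ.refl) φ.refl)
                (reflexive-≈ (δ-self k y))

    -- From a multideal to its relation and back.

    module _ {H : Fin n → Pred Carrier ℓ₁} (H-multideal : IsMultideal 𝐀 H) where
      open IsMultideal H-multideal

      classes-θ⊆ : ∀ k → classes 𝐀 (θ 𝐀 i≢j H) k ⊆ H k
      classes-θ⊆ k {x} xθe = [ proper , (λ universal → universal k x) ]′ properOrDegenerate
        where
        proper : IsProperMultideal 𝐀 H → x ∈ H k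
        proper P = respects k (sym (δ-recovers x (e k)))
          -- Each entry has its `δ` in `H i` and `e k` at position `i`, so `m2` puts it in `H k`;
          -- `m3` then absorbs the outer `q x`.
          (m3 x _ λ l → m2 (replicate n x) (proj₂ (xθe l)) (m1 k))
          where open IsProperMultideal P

      ⊆classes-θ : ∀ k → H k ⊆ classes 𝐀 (θ 𝐀 i≢j H) k
      ⊆classes-θ k {x} x∈Hk l = δ-inCenter l x (e k) ,
        [ proper , (λ universal → universal i _) ]′ properOrDegenerate
        where
        -- The entries of `δ l x (e k)` as expanded by `δ-eʳ`. Entry `k` equals `e i`, a member of
        -- `H i`, so `m2` applies with `x` in `H k`.
        ys : Vector Carrier n
        ys m = δ l (e m) (e k)

        proper : IsProperMultideal 𝐀 H → δ l x (e k) ∈ H i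
        proper P = respects i
          (trans (q-cong refl (≔-≈ ys k (sym (δ-e-self l k)))) (sym (δ-eʳ l x k)))
          (m2 ys x∈Hk (m1 i))
          where open IsProperMultideal P

theorem7p9 : ∀ {a ℓ ℓ₁ ℓ₂ : Level} (n : ℕ) → 2 ≤ n → (𝐀 : NBA n a ℓ) (i j : Fin n) (i≢j : i ≢ j) (φ : Rel (NBA.Carrier 𝐀) ℓ₁) → IsCongruence 𝐀 φ → (H : Fin n → Pred (NBA.Carrier 𝐀) ℓ₂) → IsMultideal 𝐀 H → (θ 𝐀 i≢j (classes 𝐀 φ) ⇔ φ) × (∀ k → classes 𝐀 (θ 𝐀 i≢j H) k ≐ H k)
theorem7p9 n _ 𝐀 i j i≢j φ φ-cong H H-multideal =
  (θ-classes⇒ 𝐀 i≢j φ-cong , ⇒θ-classes 𝐀 i≢j φ-cong) ,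
  λ k → classes-θ⊆ 𝐀 i≢j H-multideal k , ⊆classes-θ 𝐀 i≢j H-multideal k
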